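{- For all integers $n\ge0$, \[ E_n(-1/q,q) = \frac{1}{(1-q)^{2n}} \sum_{k=0}^n \left( \binom{2n}{n-k} - \binom{2n}{n-k-1} \right) \sum_{i=-k}^k (-q)^{i^2}. \]
   Context: Here $[n]_q=(1-q^n)/(1-q)$ and $[n]_{t,q}=(1-tq^n)/(1-q)$. The $(t,q)$-Euler numbers $E_n(t,q)$, $n\ge 0$, are defined by the continued fraction expansion (as a formal power series in $x$) \[ \sum_{n\geq0} E_{n}(t,q) x^n = \cfrac{1}{1- \cfrac{[1]_q[1]_{t,q}\, x}{1- \cfrac{[2]_q[2]_{t,q}\, x}{1-\cdots}}}, \] where the $m$-th partial coefficient is $[m]_q[m]_{t,q}$. $E_n(-1/q,q)$ is the value at $t=-1/q$. Binomial coefficients $\binom{a}{b}$ with $b<0$ are $0$. -}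

module Defs where

open import Algebra.Bundles using (CommutativeRing; Semiring)
open import Data.Fin.Base as Fin using (Fin; zero; suc; toℕ)
import Data.Fin.Properties as Fin
open import Data.Integer.Base as ℤ using (ℤ; +_; -[1+_]; _⊖_)
open import Data.Nat.Base as ℕ using (ℕ; zero; suc; _∸_; z≤n; s≤s)
open import Data.Nat.Combinatorics using (_C_)
import Data.Nat.Properties as ℕ
open import Data.Product.Base using (proj₁)
open import Data.Vec.Functional using (Vector; []; _∷_; head)
open import Level using (_⊔_)
open import Relation.Binary.PropositionalEquality as ≡ using (_≡_)

infix 6.5 _choose_

_choose_ : ℕ → ℤ → ℕ
n choose (+ k)    = n C k
n choose -[1+ _ ] = 0

module EulerNumbers {c ℓ} (R : CommutativeRing c ℓ) where

  open CommutativeRing R hiding (zero)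
  open import Algebra.Definitions _≈_ as Def using ()
  open import Algebra.Definitions.RawSemiring
    (Semiring.rawSemiring semiring) public using (_×_; _^_)
  open import Algebra.Properties.Semiring.Sum semiring public
    using (sum-syntax; sum⁺-syntax)
  open import Algebra.Properties.Semiring.Sum semiring
    using (sum-cong-≋; *-distribˡ-sum)
  open import Algebra.Properties.Ring ring using (-‿distribˡ-*; -1*x≈-x)
  open import Relation.Binary.Reasoning.Setoid setoid

  Invertible : Carrier → Set (c ⊔ ℓ)
  Invertible = Def.Invertible 1# _*_

  infixl 7 _/_

  _/_ : Carrier → {x : Carrier} → Invertible x → Carrier
  y / x-inv = y * proj₁ x-inv

  -- The sum over the integers i with - k ≤ i ≤ k.
  symmetricSum : ℕ → (ℤ → Carrier) → Carrier
  symmetricSum k f = ∑[ j ≤ 2 ℕ.* k ] f (toℕ j ⊖ k)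

  syntax symmetricSum k (λ i → e) = ∑[ ∣ i ∣≤ k ] e

  -- f n is the coefficient of xⁿ.
  PowerSeries : Set c
  PowerSeries = ℕ → Carrier

  one : PowerSeries
  one zero    = 1#
  one (suc _) = 0#

  infixl 7 _⊛_

  _⊛_ : PowerSeries → PowerSeries → PowerSeries
  (f ⊛ g) n = ∑[ i ≤ n ] (f (toℕ i) * g (n ∸ toℕ i))

  -- The series 1 - x g.
  1-x· : PowerSeries → PowerSeries
  1-x· g zero    = 1#
  1-x· g (suc n) = - g n

  -- The coefficients n, n - 1, …, 0 (in this order) of 1 / (1 - x g), by the
  -- recurrence h₀ = 1, hₙ₊₁ = g₀ hₙ + ⋯ + gₙ h₀.
  coefficients : PowerSeries → ∀ n → Vector Carrier (suc n)
  coefficients g zero    = 1# ∷ []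
  coefficients g (suc n) =
    (∑[ i ≤ n ] (g (toℕ i) * coefficients g n i)) ∷ coefficients g n

  1/1-x· : PowerSeries → PowerSeries
  1/1-x· g n = head (coefficients g n)

  -- convergent a d is the finite continued fraction
  -- 1 / (1 - a₀ x / (1 - a₁ x / ⋯ (1 - a_{d-1} x))).
  convergent : (ℕ → Carrier) → ℕ → PowerSeries
  convergent a zero    = one
  convergent a (suc d) =
    1/1-x· (λ n → a 0 * convergent (λ m → a (suc m)) d n)

  -- The x-adic limit of the convergents: by convergent-stable below, the
  -- coefficient of xⁿ is the same in all convergents of depth at least n.
  continuedFraction : (ℕ → Carrier) → PowerSeries
  continuedFraction a n = convergent a n n

  module _ (t q : Carrier) (1-q-inv : Invertible (1# - q)) where

    [_]q : ℕ → Carrier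
    [ n ]q = (1# - q ^ n) / 1-q-inv

    [_]t,q : ℕ → Carrier
    [ n ]t,q = (1# - t * q ^ n) / 1-q-inv

    E : ℕ → Carrier
    E = continuedFraction (λ m → [ suc m ]q * [ suc m ]t,q)

  coefficients-lookup : ∀ g n (i : Fin (suc n)) →
                        coefficients g n i ≡ 1/1-x· g (n ∸ toℕ i)
  coefficients-lookup g n       zero    = ≡.refl
  coefficients-lookup g (suc n) (suc i) = coefficients-lookup g n i

  1/1-x·-inverse : ∀ g n → (1-x· g ⊛ 1/1-x· g) n ≈ one n
  1/1-x·-inverse g zero    = trans (+-identityʳ _) (*-identityˡ 1#)
  1/1-x·-inverse g (suc n) = begin
    1# * S + (∑[ i ≤ n ] (- g (toℕ i) * 1/1-x· g (n ∸ toℕ i)))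
      ≈⟨ +-cong (*-identityˡ S) (sum-cong-≋ {n = suc n} λ i → begin
           - g (toℕ i) * 1/1-x· g (n ∸ toℕ i)
             ≈⟨ *-congˡ (reflexive (coefficients-lookup g n i)) ⟨
           - g (toℕ i) * coefficients g n i
             ≈⟨ -‿distribˡ-* _ _ ⟨
           - (g (toℕ i) * coefficients g n i)
             ≈⟨ -1*x≈-x _ ⟨
           - 1# * (g (toℕ i) * coefficients g n i) ∎) ⟩
    S + (∑[ i ≤ n ] (- 1# * (g (toℕ i) * coefficients g n i)))
      ≈⟨ +-congˡ (*-distribˡ-sum (- 1#) terms) ⟨
    S + - 1# * S
      ≈⟨ +-congˡ (-1*x≈-x S) ⟩
    S - S
      ≈⟨ -‿inverseʳ S ⟩
    0# ∎
    where
    terms : Vector Carrier (suc n)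
    terms i = g (toℕ i) * coefficients g n i

    S : Carrier
    S = ∑[ i ≤ n ] terms i

  coefficients-cong : ∀ {g h} n → (∀ m → m ℕ.< n → g m ≈ h m) →
                      ∀ i → coefficients g n i ≈ coefficients h n i
  coefficients-cong zero    g≈h zero    = refl
  coefficients-cong (suc n) g≈h zero    = sum-cong-≋ {n = suc n} λ i →
    *-cong (g≈h (toℕ i) (Fin.toℕ<n i))
           (coefficients-cong n (λ m m<n → g≈h m (ℕ.m<n⇒m<1+n m<n)) i)
  coefficients-cong (suc n) g≈h (suc i) =
    coefficients-cong n (λ m m<n → g≈h m (ℕ.m<n⇒m<1+n m<n)) i

  convergent-stable : ∀ a n {d e} → n ℕ.≤ d → n ℕ.≤ e →
                      convergent a d n ≈ convergent a e n
  convergent-stable a zero    {zero}  {zero}  _ _ = refl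
  convergent-stable a zero    {zero}  {suc e} _ _ = refl
  convergent-stable a zero    {suc d} {zero}  _ _ = refl
  convergent-stable a zero    {suc d} {suc e} _ _ = refl
  convergent-stable a (suc n) (s≤s n≤d) (s≤s n≤e) =
    coefficients-cong (suc n) (λ { m (s≤s m≤n) → *-congˡ
      (convergent-stable (λ k → a (suc k)) m
        (ℕ.≤-trans m≤n n≤d) (ℕ.≤-trans m≤n n≤e)) }) zero

module Submission where

-- Put w = (1 - q)⁻² and aₕ = (1 - qʰ⁺¹)(1 + qʰ), so that the coefficients of
-- the continued fraction at t = -1/q are w a₀, w a₁, ….  The numbers aₕ are the
-- recurrence coefficients of the Al-Salam–Chihara polynomials Qₕ with
-- parameters 1 and -1, in the variable z + z⁻¹, whose weight is a theta
-- function: they are orthogonal for the functional L with L(z²ʳ) = (-q)^(r²)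
-- and L(z²ʳ⁺¹) = 0.  Moreover L(zˢ Qₕ) is an explicit product, which makes the
-- orthogonality a polynomial identity.  Hence Eₙ = wⁿ L((z + z⁻¹)²ⁿ), and the
-- theorem follows by expanding (z + z⁻¹)²ⁿ in the Chebyshev polynomials
-- z²ᵏ + z²ᵏ⁻² + ⋯ + z⁻²ᵏ, whose coefficients are the ballot numbers
-- (2n choose n-k) - (2n choose n-k-1).

open import Defs
open import Algebra.Bundles using (CommutativeRing)
import Algebra.Solver.Ring
open import Algebra.Solver.Ring.AlmostCommutativeRing
  using (fromCommutativeRing; _-Raw-AlmostCommutative⟶_)
open import Data.Fin.Base using (toℕ)
import Data.Fin.Properties as Fin
open import Data.Integer.Base as ℤ using (ℤ; +_; -[1+_]; ∣_∣; _⊖_)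
import Data.Integer.Properties as ℤ
open import Data.Maybe.Base using (Maybe; just; nothing)
open import Data.Nat.Base as ℕ using (ℕ; zero; suc; _∸_; z≤n; s≤s)
open import Data.Nat.Combinatorics using (_C_; nCk≡nC[n∸k]; nCk+nC[k+1]≡[n+1]C[k+1])
import Data.Nat.Properties as ℕ
open import Data.Nat.Solver using (module +-*-Solver)
open import Data.Product.Base using (proj₁; proj₂)
open import Data.Sign.Base as Sign using (Sign)
open import Data.Vec.Functional using (Vector)
open import Function.Base using (_∘_)
open import Relation.Binary.PropositionalEquality as ≡ using (_≡_)
open import Relation.Nullary.Decidable.Core using (yes; no)

-- Normalisation of polynomial identities with integer coefficients over a commutative ring.

module IntegerCoefficients {c ℓ} (R : CommutativeRing c ℓ) where

  open CommutativeRing R hiding (zero)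
  open import Algebra.Properties.AbelianGroup +-abelianGroup using (⁻¹-∙-comm)
  open import Algebra.Properties.Group +-group using (ε⁻¹≈ε; ⁻¹-involutive)
  open import Algebra.Properties.Ring ring using (-‿distribˡ-*; -‿distribʳ-*)
  open import Algebra.Properties.Semiring.Mult.TCOptimised semiring
    using (_×_; 1+×; ×-homo-+; ×1-homo-*)
  open import Relation.Binary.Reasoning.Setoid setoid

  -- With the optimised `_×_`, the images of 0 and 1 reduce to `0#` and `1#`, so solver constants
  -- match goals by computation.
  fromℤ : ℤ → Carrier
  fromℤ (+ n)    = n × 1#
  fromℤ -[1+ n ] = - (suc n × 1#)

  fromℤ-⊖ : ∀ m n → fromℤ (m ⊖ n) ≈ m × 1# - n × 1#
  fromℤ-⊖ m       zero    = begin
    m × 1#         ≈⟨ +-identityʳ _ ⟨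
    m × 1# + 0#    ≈⟨ +-congˡ ε⁻¹≈ε ⟨
    m × 1# - 0#    ∎
  fromℤ-⊖ zero    (suc n) = sym (+-identityˡ _)
  fromℤ-⊖ (suc m) (suc n) = begin
    fromℤ (suc m ⊖ suc n)                    ≡⟨ ≡.cong fromℤ (ℤ.[1+m]⊖[1+n]≡m⊖n m n) ⟩
    fromℤ (m ⊖ n)                            ≈⟨ fromℤ-⊖ m n ⟩
    x - y                                    ≈⟨ +-congʳ (+-identityˡ x) ⟨
    0# + x - y                               ≈⟨ +-congʳ (+-congʳ (-‿inverseʳ 1#)) ⟨
    1# - 1# + x - y                          ≈⟨ +-congʳ (+-assoc _ _ _) ⟩
    1# + (- 1# + x) - y                      ≈⟨ +-congʳ (+-congˡ (+-comm _ _)) ⟩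
    1# + (x - 1#) - y                        ≈⟨ +-congʳ (+-assoc _ _ _) ⟨
    1# + x - 1# - y                          ≈⟨ +-assoc _ _ _ ⟩
    1# + x + (- 1# - y)                      ≈⟨ +-congˡ (⁻¹-∙-comm _ _) ⟩
    1# + x - (1# + y)                        ≈⟨ +-cong (1+× m 1#) (-‿cong (1+× n 1#)) ⟨
    suc m × 1# - suc n × 1#                  ∎
    where
    x = m × 1#
    y = n × 1#

  fromℤ-+ : ∀ i j → fromℤ (i ℤ.+ j) ≈ fromℤ i + fromℤ j
  fromℤ-+ (+ m)    (+ n)    = ×-homo-+ 1# m n
  fromℤ-+ (+ m)    -[1+ n ] = fromℤ-⊖ m (suc n)
  fromℤ-+ -[1+ m ] (+ n)    = trans (fromℤ-⊖ n (suc m)) (+-comm _ _)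
  fromℤ-+ -[1+ m ] -[1+ n ] = begin
    - (suc (suc (m ℕ.+ n)) × 1#)     ≡⟨ ≡.cong (λ k → - (suc k × 1#)) (ℕ.+-suc m n) ⟨
    - ((suc m ℕ.+ suc n) × 1#)       ≈⟨ -‿cong (×-homo-+ 1# (suc m) (suc n)) ⟩
    - (suc m × 1# + suc n × 1#)      ≈⟨ ⁻¹-∙-comm _ _ ⟨
    - (suc m × 1#) - (suc n × 1#)    ∎

  fromℤ-- : ∀ i → fromℤ (ℤ.- i) ≈ - fromℤ i
  fromℤ-- (+ zero)  = sym ε⁻¹≈ε
  fromℤ-- (+ suc n) = refl
  fromℤ-- -[1+ n ]  = sym (⁻¹-involutive _)

  fromℤ--◃ : ∀ n → fromℤ (Sign.- ℤ.◃ n) ≈ - (n × 1#)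
  fromℤ--◃ zero    = sym ε⁻¹≈ε
  fromℤ--◃ (suc n) = refl

  fromℤ-* : ∀ i j → fromℤ (i ℤ.* j) ≈ fromℤ i * fromℤ j
  fromℤ-* (+ m)    (+ n)    = begin
    fromℤ (Sign.+ ℤ.◃ m ℕ.* n)  ≡⟨ ≡.cong fromℤ (ℤ.+◃n≡+n (m ℕ.* n)) ⟩
    (m ℕ.* n) × 1#              ≈⟨ ×1-homo-* m n ⟩
    m × 1# * (n × 1#)           ∎
  fromℤ-* (+ m)    -[1+ n ] = begin
    fromℤ (Sign.- ℤ.◃ m ℕ.* suc n)  ≈⟨ fromℤ--◃ (m ℕ.* suc n) ⟩
    - ((m ℕ.* suc n) × 1#)          ≈⟨ -‿cong (×1-homo-* m (suc n)) ⟩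
    - (m × 1# * (suc n × 1#))       ≈⟨ -‿distribʳ-* _ _ ⟩
    m × 1# * - (suc n × 1#)         ∎
  fromℤ-* -[1+ m ] (+ n)    = begin
    fromℤ (Sign.- ℤ.◃ suc m ℕ.* n)  ≈⟨ fromℤ--◃ (suc m ℕ.* n) ⟩
    - ((suc m ℕ.* n) × 1#)          ≈⟨ -‿cong (×1-homo-* (suc m) n) ⟩
    - (suc m × 1# * (n × 1#))       ≈⟨ -‿distribˡ-* _ _ ⟩
    - (suc m × 1#) * (n × 1#)       ∎
  fromℤ-* -[1+ m ] -[1+ n ] = begin
    (suc m ℕ.* suc n) × 1#            ≈⟨ ×1-homo-* (suc m) (suc n) ⟩
    x * y                             ≈⟨ ⁻¹-involutive _ ⟨
    - - (x * y)                       ≈⟨ -‿cong (-‿distribʳ-* _ _) ⟩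
    - (x * - y)                       ≈⟨ -‿distribˡ-* _ _ ⟩
    - x * - y                         ∎
    where
    x = suc m × 1#
    y = suc n × 1#

  fromℤ-homomorphism : ℤ.+-*-rawRing -Raw-AlmostCommutative⟶ fromCommutativeRing R
  fromℤ-homomorphism = record
    { ⟦_⟧    = fromℤ
    ; +-homo = fromℤ-+
    ; *-homo = fromℤ-*
    ; -‿homo = fromℤ--
    ; 0-homo = refl
    ; 1-homo = refl
    }

  fromℤ-≟ : ∀ i j → Maybe (fromℤ i ≈ fromℤ j)
  fromℤ-≟ i j with i ℤ.≟ j
  ... | yes i≡j = just (reflexive (≡.cong fromℤ i≡j))
  ... | no  _   = nothing

  open Algebra.Solver.Ring ℤ.+-*-rawRing (fromCommutativeRing R)
    fromℤ-homomorphism fromℤ-≟ public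
    using (solve; con; _:=_; _:+_; _:*_; _:-_; :-_)

-- Power series and continued fractions.

module ContinuedFractions {c ℓ} (R : CommutativeRing c ℓ) where

  open CommutativeRing R hiding (zero)
  open EulerNumbers R
  open import Algebra.Properties.Semiring.Sum semiring
    using (sum-cong-≋; *-distribˡ-sum; ∑-distrib-+)
  open import Relation.Binary.Reasoning.Setoid setoid
  open IntegerCoefficients R

  infixr 7 _·_

  _·_ : Carrier → PowerSeries → PowerSeries
  (x · f) n = x * f n

  terms : PowerSeries → PowerSeries → ∀ n → Vector Carrier (suc n)
  terms f g n i = f (toℕ i) * g (n ∸ toℕ i)

  ⊛-cong : ∀ {f f′ g g′} n → (∀ i → i ℕ.≤ n → f i ≈ f′ i) →
           (∀ i → i ℕ.≤ n → g i ≈ g′ i) → (f ⊛ g) n ≈ (f′ ⊛ g′) n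
  ⊛-cong n f≈f′ g≈g′ = sum-cong-≋ {n = suc n} λ i →
    *-cong (f≈f′ (toℕ i) (Fin.toℕ≤pred[n] i)) (g≈g′ (n ∸ toℕ i) (ℕ.m∸n≤m n (toℕ i)))

  ·-⊛ : ∀ x f g n → ((x · f) ⊛ g) n ≈ x * (f ⊛ g) n
  ·-⊛ x f g n = begin
    ((x · f) ⊛ g) n
      ≈⟨ sum-cong-≋ {n = suc n} (λ i → *-assoc x (f (toℕ i)) (g (n ∸ toℕ i))) ⟩
    ∑[ i ≤ n ] (x * (f (toℕ i) * g (n ∸ toℕ i)))
      ≈⟨ *-distribˡ-sum x (terms f g n) ⟨
    x * (f ⊛ g) n
      ∎

  ⊛-· : ∀ x f g n → (f ⊛ (x · g)) n ≈ x * (f ⊛ g) n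
  ⊛-· x f g n = begin
    (f ⊛ (x · g)) n
      ≈⟨ sum-cong-≋ {n = suc n} (λ i →
           solve 3 (λ x y z → y :* (x :* z) := x :* (y :* z)) refl
             x (f (toℕ i)) (g (n ∸ toℕ i))) ⟩
    ∑[ i ≤ n ] (x * (f (toℕ i) * g (n ∸ toℕ i)))
      ≈⟨ *-distribˡ-sum x (terms f g n) ⟨
    x * (f ⊛ g) n
      ∎

  ⊛-distribʳ : ∀ f g h n → ((λ i → f i + g i) ⊛ h) n ≈ (f ⊛ h) n + (g ⊛ h) n
  ⊛-distribʳ f g h n = trans
    (sum-cong-≋ {n = suc n} λ i → distribʳ (h (n ∸ toℕ i)) (f (toℕ i)) (g (toℕ i)))
    (∑-distrib-+ (terms f h n) (terms g h n))

  -- By computation `f ⊛ g` at `suc n` is `f 0 * g (suc n) + (f ∘ suc ⊛ g) n`, so induction on `n`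
  -- with `f` varying needs only distributivity and scalars.
  ⊛-assoc : ∀ f g h n → ((f ⊛ g) ⊛ h) n ≈ (f ⊛ (g ⊛ h)) n
  ⊛-assoc f g h zero    = solve 3 (λ x y z →
    (x :* y :+ con (+ 0)) :* z :+ con (+ 0) := x :* (y :* z :+ con (+ 0)) :+ con (+ 0))
    refl (f 0) (g 0) (h 0)
  ⊛-assoc f g h (suc n) = begin
    (f 0 * g 0 + 0#) * h (suc n) + ((λ i → f 0 * g (suc i) + (f ∘ suc ⊛ g) i) ⊛ h) n
      ≈⟨ +-congˡ (⊛-distribʳ (f 0 · g ∘ suc) (f ∘ suc ⊛ g) h n) ⟩
    (f 0 * g 0 + 0#) * h (suc n) + (((f 0 · g ∘ suc) ⊛ h) n + ((f ∘ suc ⊛ g) ⊛ h) n)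
      ≈⟨ +-congˡ (+-cong (·-⊛ (f 0) (g ∘ suc) h n) (⊛-assoc (f ∘ suc) g h n)) ⟩
    (f 0 * g 0 + 0#) * h (suc n) + (f 0 * (g ∘ suc ⊛ h) n + (f ∘ suc ⊛ (g ⊛ h)) n)
      ≈⟨ solve 5 (λ x y z u v → (x :* y :+ con (+ 0)) :* z :+ (x :* u :+ v)
                              := x :* (y :* z :+ u) :+ v) refl (f 0) (g 0) (h (suc n)) _ _ ⟩
    f 0 * (g 0 * h (suc n) + (g ∘ suc ⊛ h) n) + (f ∘ suc ⊛ (g ⊛ h)) n
      ∎

  ⊛-identityʳ : ∀ f n → (f ⊛ one) n ≈ f n
  ⊛-identityʳ f zero    = trans (+-identityʳ _) (*-identityʳ _)
  ⊛-identityʳ f (suc n) = begin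
    f 0 * 0# + (f ∘ suc ⊛ one) n  ≈⟨ +-cong (zeroʳ (f 0)) (⊛-identityʳ (f ∘ suc) n) ⟩
    0# + f (suc n)                ≈⟨ +-identityˡ _ ⟩
    f (suc n)                     ∎

  -- This is K = 1 + a₀ x K′ K. The convergents that occur on the left have depths `n` and `suc n`;
  -- stability replaces them by the diagonal ones.
  continuedFraction-suc : ∀ a n → continuedFraction a (suc n)
    ≈ a 0 * (continuedFraction (a ∘ suc) ⊛ continuedFraction a) n
  continuedFraction-suc a n = begin
    ∑[ i ≤ n ] (a 0 * convergent (a ∘ suc) n (toℕ i) * coefficients g n i)
      ≈⟨ sum-cong-≋ {n = suc n} (λ i → *-cong
           (*-congˡ {a 0} (convergent-stable (a ∘ suc) (toℕ i) (Fin.toℕ≤pred[n] i) ℕ.≤-refl))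
           (trans (reflexive (coefficients-lookup g n i))
                  (convergent-stable a (n ∸ toℕ i) {suc n}
                    (ℕ.≤-trans (ℕ.m∸n≤m n (toℕ i)) (ℕ.n≤1+n n)) ℕ.≤-refl))) ⟩
    ((a 0 · continuedFraction (a ∘ suc)) ⊛ continuedFraction a) n
      ≈⟨ ·-⊛ (a 0) (continuedFraction (a ∘ suc)) (continuedFraction a) n ⟩
    a 0 * (continuedFraction (a ∘ suc) ⊛ continuedFraction a) n
      ∎
    where
    g : PowerSeries
    g m = a 0 * convergent (a ∘ suc) n m

  -- G₀ = f + x G₁ and Gₕ₊₁ = aₕ Gₕ + x Gₕ₊₂ as power series in x; the solution
  -- is Gₕ₊₁ = aₕ Kₕ₊₁ Gₕ, where Kₕ is the continued fraction with coefficients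
  -- aₕ, aₕ₊₁, …, and G₀ = K₀ f.
  record Contiguous (a : ℕ → Carrier) (f : PowerSeries) (G : ℕ → PowerSeries) : Set ℓ where
    field
      start-zero : G 0 0 ≈ f 0
      start-suc  : ∀ n → G 0 (suc n) ≈ f (suc n) + G 1 n
      step-zero  : ∀ h → G (suc h) 0 ≈ a h * G h 0
      step-suc   : ∀ h n → G (suc h) (suc n) ≈ a h * G h (suc n) + G (suc (suc h)) n

  open Contiguous

  -- The relation G₁ = a₀ G₀ + x G₂ is itself a start relation, with inhomogeneous term a₀ G₀.
  shift : ∀ {a f G} → Contiguous a f G → Contiguous (a ∘ suc) (a 0 · G 0) (G ∘ suc)
  shift contiguous .start-zero = step-zero contiguous 0
  shift contiguous .start-suc  = step-suc contiguous 0
  shift contiguous .step-zero  = step-zero contiguous ∘ suc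
  shift contiguous .step-suc   = step-suc contiguous ∘ suc

  -- Induction on the shifted family gives G₁ = a₀ K′ G₀, so G₀ = f + a₀ x K′ G₀, the equation that
  -- K f satisfies by `continuedFraction-suc`. The bound `n` makes the induction strong: index
  -- `suc m` needs G₀ at all indices up to `m`.
  contiguous⇒continuedFraction-≤ : ∀ n {a f G} → Contiguous a f G →
    ∀ m → m ℕ.≤ n → G 0 m ≈ (continuedFraction a ⊛ f) m
  contiguous⇒continuedFraction-≤ n {a} {f} {G} contiguous zero _ = begin
    G 0 0            ≈⟨ start-zero contiguous ⟩
    f 0              ≈⟨ solve 1 (λ x → x := con (+ 1) :* x :+ con (+ 0)) refl (f 0) ⟩
    1# * f 0 + 0#    ∎
  contiguous⇒continuedFraction-≤ (suc n) {a} {f} {G} contiguous (suc m) (s≤s m≤n) = begin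
    G 0 (suc m)
      ≈⟨ start-suc contiguous m ⟩
    f (suc m) + G 1 m
      ≈⟨ +-congˡ (contiguous⇒continuedFraction-≤ n (shift contiguous) m m≤n) ⟩
    f (suc m) + (K′ ⊛ (a 0 · G 0)) m
      ≈⟨ +-congˡ (⊛-· (a 0) K′ (G 0) m) ⟩
    f (suc m) + a 0 * (K′ ⊛ G 0) m
      ≈⟨ +-congˡ (*-congˡ (⊛-cong {K′} m (λ _ _ → refl) λ i i≤m →
           contiguous⇒continuedFraction-≤ n contiguous i (ℕ.≤-trans i≤m m≤n))) ⟩
    f (suc m) + a 0 * (K′ ⊛ (K ⊛ f)) m
      ≈⟨ +-congˡ (*-congˡ (⊛-assoc K′ K f m)) ⟨
    f (suc m) + a 0 * ((K′ ⊛ K) ⊛ f) m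
      ≈⟨ +-congˡ (·-⊛ (a 0) (K′ ⊛ K) f m) ⟨
    f (suc m) + ((a 0 · (K′ ⊛ K)) ⊛ f) m
      ≈⟨ +-cong (*-identityˡ _) (⊛-cong {g = f} m (λ i _ → continuedFraction-suc a i) (λ _ _ → refl)) ⟨
    1# * f (suc m) + (K ∘ suc ⊛ f) m
      ∎
    where
    K K′ : PowerSeries
    K  = continuedFraction a
    K′ = continuedFraction (a ∘ suc)

  contiguous⇒continuedFraction : ∀ {a G} → Contiguous a one G →
    ∀ n → G 0 n ≈ continuedFraction a n
  contiguous⇒continuedFraction {a} contiguous n = trans
    (contiguous⇒continuedFraction-≤ n contiguous n ℕ.≤-refl)
    (⊛-identityʳ (continuedFraction a) n)

-- Binomial coefficients with integer lower index.

choose-suc : ∀ n z → suc n choose z ≡ n choose z ℕ.+ n choose ℤ.pred z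
choose-suc n (+ zero)  = ≡.refl
choose-suc n (+ suc k) = ≡.trans (≡.sym (nCk+nC[k+1]≡[n+1]C[k+1] n k)) (ℕ.+-comm (n C k) _)
choose-suc n -[1+ k ]  = ≡.refl

choose-suc-suc : ∀ n z → suc (suc n) choose z ≡
  n choose z ℕ.+ 2 ℕ.* (n choose ℤ.pred z) ℕ.+ n choose ℤ.pred (ℤ.pred z)
choose-suc-suc n z = begin
  suc (suc n) choose z
    ≡⟨ choose-suc (suc n) z ⟩
  suc n choose z ℕ.+ suc n choose ℤ.pred z
    ≡⟨ ≡.cong₂ ℕ._+_ (choose-suc n z) (choose-suc n (ℤ.pred z)) ⟩
  n choose z ℕ.+ n choose ℤ.pred z ℕ.+ (n choose ℤ.pred z ℕ.+ n choose ℤ.pred (ℤ.pred z))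
    ≡⟨ +-*-Solver.solve 3 (λ x y z → let open +-*-Solver in
         x :+ y :+ (y :+ z) := x :+ con 2 :* y :+ z) ≡.refl (n choose z) _ _ ⟩
  n choose z ℕ.+ 2 ℕ.* (n choose ℤ.pred z) ℕ.+ n choose ℤ.pred (ℤ.pred z)
    ∎
  where open ≡.≡-Reasoning

pred-⊖ : ∀ m n → ℤ.pred (m ⊖ n) ≡ m ⊖ suc n
pred-⊖ m n = ℤ.distribʳ-⊖-+-neg 0 m n

-- The coefficient of z²ᵏ in (z + z⁻¹)²ⁿ.
central : ℕ → ℕ → ℕ
central n k = (2 ℕ.* n) choose (n ⊖ k)

central-vanishes : ∀ {n k} → n ℕ.< k → central n k ≡ 0
-- `n ⊖ k` becomes minus `k ∸ n`, whose positivity excludes the lower index 0.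
central-vanishes {n} {k} n<k rewrite ℤ.⊖-< n<k with k ∸ n | ℕ.m<n⇒0<n∸m n<k
... | suc _ | _ = ≡.refl

-- The recurrence at k = 0 involves the neighbour k = -1, outside the domain of `central`; the
-- symmetry k ↦ -k replaces it by k = 1.
central-symmetric : ∀ n → (2 ℕ.* n) choose (+ suc n) ≡ central n 1
central-symmetric zero    = ≡.refl
central-symmetric (suc n) = ≡.trans (nCk≡nC[n∸k] (s≤s n<n+n+1))
  (≡.cong ((2 ℕ.* suc n) C_) (begin
    n ℕ.+ suc (n ℕ.+ 0) ∸ suc n    ≡⟨ ≡.cong (_∸ suc n) (ℕ.+-suc n (n ℕ.+ 0)) ⟩
    n ℕ.+ (n ℕ.+ 0) ∸ n            ≡⟨ ℕ.m+n∸m≡n n (n ℕ.+ 0) ⟩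
    n ℕ.+ 0                        ≡⟨ ℕ.+-identityʳ n ⟩
    n                              ∎))
  where
  open ≡.≡-Reasoning

  n<n+n+1 : n ℕ.< n ℕ.+ suc (n ℕ.+ 0)
  n<n+n+1 = ℕ.≤-trans (s≤s (ℕ.m≤m+n n _)) (ℕ.≤-reflexive (≡.sym (ℕ.+-suc n _)))

central-suc : ∀ n z → (2 ℕ.* suc n) choose z ≡
  (2 ℕ.* n) choose z ℕ.+ 2 ℕ.* ((2 ℕ.* n) choose ℤ.pred z) ℕ.+ (2 ℕ.* n) choose ℤ.pred (ℤ.pred z)
central-suc n z = ≡.trans (≡.cong (_choose z) (ℕ.*-suc 2 n)) (choose-suc-suc (2 ℕ.* n) z)

central-suc-zero : ∀ n → central (suc n) 0 ≡ 2 ℕ.* central n 0 ℕ.+ 2 ℕ.* central n 1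
central-suc-zero n = ≡.trans (central-suc n (+ suc n)) (begin
  (2 ℕ.* n) choose (+ suc n) ℕ.+ 2 ℕ.* central n 0 ℕ.+ (2 ℕ.* n) choose ℤ.pred (n ⊖ 0)
    ≡⟨ ≡.cong₂ (λ x y → x ℕ.+ 2 ℕ.* central n 0 ℕ.+ (2 ℕ.* n) choose y)
         (central-symmetric n) (pred-⊖ n 0) ⟩
  central n 1 ℕ.+ 2 ℕ.* central n 0 ℕ.+ central n 1
    ≡⟨ +-*-Solver.solve 2 (λ x y → let open +-*-Solver in
         y :+ con 2 :* x :+ y := con 2 :* x :+ con 2 :* y) ≡.refl (central n 0) (central n 1) ⟩
  2 ℕ.* central n 0 ℕ.+ 2 ℕ.* central n 1
    ∎)
  where open ≡.≡-Reasoning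

central-suc-suc : ∀ n k → central (suc n) (suc k) ≡
  central n k ℕ.+ 2 ℕ.* central n (suc k) ℕ.+ central n (suc (suc k))
central-suc-suc n k = begin
  (2 ℕ.* suc n) choose (suc n ⊖ suc k)
    ≡⟨ ≡.cong ((2 ℕ.* suc n) choose_) (ℤ.[1+m]⊖[1+n]≡m⊖n n k) ⟩
  (2 ℕ.* suc n) choose (n ⊖ k)
    ≡⟨ central-suc n (n ⊖ k) ⟩
  central n k ℕ.+ 2 ℕ.* ((2 ℕ.* n) choose ℤ.pred (n ⊖ k))
    ℕ.+ (2 ℕ.* n) choose ℤ.pred (ℤ.pred (n ⊖ k))
    ≡⟨ ≡.cong₂ (λ x y → central n k ℕ.+ 2 ℕ.* ((2 ℕ.* n) choose x) ℕ.+ (2 ℕ.* n) choose y)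
         (pred-⊖ n k) (≡.trans (≡.cong ℤ.pred (pred-⊖ n k)) (pred-⊖ n (suc k))) ⟩
  central n k ℕ.+ 2 ℕ.* central n (suc k) ℕ.+ central n (suc (suc k))
    ∎
  where open ≡.≡-Reasoning

-- Moments of a symmetric functional and ballot numbers.

module Walks {c ℓ} (R : CommutativeRing c ℓ) where

  open CommutativeRing R hiding (zero)
  open EulerNumbers R
  open import Algebra.Properties.Semiring.Sum semiring using (sum-cong-≋; sum-init-last)
  open import Algebra.Properties.Semiring.Mult semiring using (×-homo-+; ×-congˡ)
  open import Relation.Binary.Reasoning.Setoid setoid
  open IntegerCoefficients R

  Sequence : Set c
  Sequence = ℕ → Carrier

  -- If f s is the value of a linear functional at the s-th Laurent polynomial
  -- (zˢ + z⁻ˢ)/2, then X f is obtained by multiplying these by z + z⁻¹.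
  X : Sequence → Sequence
  X f zero    = f 1 + f 1
  X f (suc s) = f (suc (suc s)) + f s

  -- The value of the functional at (z + z⁻¹)ⁿ: after `n` multiplications it is read off at the
  -- Laurent polynomial 1.
  moment : ℕ → Sequence → Carrier
  moment zero    f = f 0
  moment (suc n) f = moment n (X f)

  X-cong : ∀ {f g} → (∀ s → f s ≈ g s) → ∀ s → X f s ≈ X g s
  X-cong f≈g zero    = +-cong (f≈g 1) (f≈g 1)
  X-cong f≈g (suc s) = +-cong (f≈g (suc (suc s))) (f≈g s)

  moment-cong : ∀ n {f g} → (∀ s → f s ≈ g s) → moment n f ≈ moment n g
  moment-cong zero    f≈g = f≈g 0
  moment-cong (suc n) f≈g = moment-cong n (X-cong f≈g)

  X-linear : ∀ x f g s → X (λ s → f s + x * g s) s ≈ X f s + x * X g s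
  X-linear x f g zero    = solve 3 (λ x y z →
    y :+ x :* z :+ (y :+ x :* z) := y :+ y :+ x :* (z :+ z)) refl x (f 1) (g 1)
  X-linear x f g (suc s) = solve 5 (λ x y z u v →
    y :+ x :* z :+ (u :+ x :* v) := y :+ u :+ x :* (z :+ v))
    refl x (f (suc (suc s))) (g (suc (suc s))) (f s) (g s)

  moment-linear : ∀ n x f g → moment n (λ s → f s + x * g s) ≈ moment n f + x * moment n g
  moment-linear zero    x f g = refl
  moment-linear (suc n) x f g =
    trans (moment-cong n (X-linear x f g)) (moment-linear n x (X f) (X g))

  X-vanishes : ∀ n {f} → (∀ s → s ℕ.≤ suc n → f s ≈ 0#) → ∀ s → s ℕ.≤ n → X f s ≈ 0#
  X-vanishes n f≈0 zero    _   =
    trans (+-cong (f≈0 1 (s≤s z≤n)) (f≈0 1 (s≤s z≤n))) (+-identityˡ 0#)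
  X-vanishes n f≈0 (suc s) s<n = trans
    (+-cong (f≈0 (suc (suc s)) (s≤s s<n))
            (f≈0 s (ℕ.≤-trans (ℕ.<⇒≤ s<n) (ℕ.n≤1+n n))))
    (+-identityˡ 0#)

  -- Only powers zˢ with |s| ≤ n occur in (z + z⁻¹)ⁿ.
  moment-vanishes : ∀ n {f} → (∀ s → s ℕ.≤ n → f s ≈ 0#) → moment n f ≈ 0#
  moment-vanishes zero    f≈0 = f≈0 0 z≤n
  moment-vanishes (suc n) f≈0 = moment-vanishes n (X-vanishes n f≈0)

  -- f 0 + 2 (f 2 + f 4 + ⋯ + f 2k), the value at the Chebyshev polynomial
  -- z²ᵏ + z²ᵏ⁻² + ⋯ + z⁻²ᵏ.
  partialSum : Sequence → Sequence
  partialSum f zero    = f 0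
  partialSum f (suc k) = partialSum f k + (f (suc k ℕ.* 2) + f (suc k ℕ.* 2))

  -- The effect on partial sums of multiplication by (z + z⁻¹)².
  Y : Sequence → Sequence
  Y f zero    = f 1 + f 0
  Y f (suc k) = f (suc (suc k)) + (f (suc k) + f (suc k)) + f k

  -- With Uₖ = z²ᵏ + ⋯ + z⁻²ᵏ this is (z + z⁻¹)² Uₖ = Uₖ₊₁ + 2 Uₖ + Uₖ₋₁, and U₁ + U₀ for k = 0. The
  -- case `suc zero` is separate because `Y` has a different rule at 0.
  partialSum-X² : ∀ f k → partialSum (X (X f)) k ≈ Y (partialSum f) k
  partialSum-X² f zero = solve 2 (λ x y →
    y :+ x :+ (y :+ x) := x :+ (y :+ y) :+ x) refl (f 0) (f 2)
  partialSum-X² f (suc zero) = solve 3 (λ x y z →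
    y :+ x :+ (y :+ x) :+ (z :+ y :+ (y :+ x) :+ (z :+ y :+ (y :+ x))) :=
    x :+ (y :+ y) :+ (z :+ z) :+ (x :+ (y :+ y) :+ (x :+ (y :+ y))) :+ x)
    refl (f 0) (f 2) (f 4)
  partialSum-X² f (suc (suc k)) = trans (+-congʳ (partialSum-X² f (suc k)))
    (solve 4 (λ t x y z →
      let t′ = t :+ (x :+ x)
          t″ = t′ :+ (y :+ y)
      in t″ :+ (t′ :+ t′) :+ t :+ (z :+ y :+ (y :+ x) :+ (z :+ y :+ (y :+ x))) :=
         t″ :+ (z :+ z) :+ (t″ :+ t″) :+ t′)
      refl (partialSum f k) (f (suc k ℕ.* 2)) (f (suc (suc k) ℕ.* 2))
           (f (suc (suc (suc k)) ℕ.* 2)))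

  ∑≤-last : ∀ n (f : ℕ → Carrier) →
            ∑[ i ≤ suc n ] f (toℕ i) ≈ ∑[ i ≤ n ] f (toℕ i) + f (suc n)
  ∑≤-last n f = trans (sum-init-last {suc n} (f ∘ toℕ)) (+-cong
    (sum-cong-≋ {suc n} λ i → reflexive (≡.cong f (Fin.toℕ-inject₁ i)))
    (reflexive (≡.cong f (Fin.toℕ-fromℕ (suc n)))))

  -- The coefficient of Uₖ in (z + z⁻¹)²ⁿ, since z²ᵏ + z⁻²ᵏ = Uₖ - Uₖ₋₁ for k ≥ 1. The difference is
  -- taken in the ring, where subtraction does not truncate.
  ballot : ℕ → ℕ → Carrier
  ballot n k = central n k × 1# - central n (suc k) × 1#

  ×-homo-2* : ∀ m x → (2 ℕ.* m) × x ≈ m × x + m × x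
  ×-homo-2* m x = trans (×-homo-+ x m (m ℕ.+ 0))
    (+-congˡ (×-congˡ (ℕ.+-identityʳ m)))

  central-suc-suc-× : ∀ n k → central (suc n) (suc k) × 1# ≈
    central n k × 1# + (central n (suc k) × 1# + central n (suc k) × 1#)
      + central n (suc (suc k)) × 1#
  central-suc-suc-× n k = begin
    central (suc n) (suc k) × 1#           ≈⟨ ×-congˡ (central-suc-suc n k) ⟩
    (x ℕ.+ 2 ℕ.* y ℕ.+ z) × 1#             ≈⟨ ×-homo-+ 1# (x ℕ.+ 2 ℕ.* y) z ⟩
    (x ℕ.+ 2 ℕ.* y) × 1# + z × 1#          ≈⟨ +-congʳ (×-homo-+ 1# x (2 ℕ.* y)) ⟩
    x × 1# + (2 ℕ.* y) × 1# + z × 1#       ≈⟨ +-congʳ (+-congˡ (×-homo-2* y 1#)) ⟩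
    x × 1# + (y × 1# + y × 1#) + z × 1#    ∎
    where
    x y z : ℕ
    x = central n k
    y = central n (suc k)
    z = central n (suc (suc k))

  -- This recurrence and `ballot-suc-suc` have the coefficients of `Y`, a symmetric tridiagonal
  -- matrix with diagonal 1, 2, 2, .... Hence `Y` can be moved from a sequence onto the ballot
  -- numbers.
  ballot-suc-zero : ∀ n → ballot (suc n) 0 ≈ ballot n 0 + ballot n 1
  ballot-suc-zero n = begin
    central (suc n) 0 × 1# - central (suc n) 1 × 1#
      ≈⟨ +-cong (trans (×-congˡ (central-suc-zero n))
           (trans (×-homo-+ 1# (2 ℕ.* central n 0) (2 ℕ.* central n 1))
             (+-cong (×-homo-2* (central n 0) 1#) (×-homo-2* (central n 1) 1#))))
           (-‿cong (central-suc-suc-× n 0)) ⟩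
    _
      ≈⟨ solve 3 (λ x y z → x :+ x :+ (y :+ y) :- (x :+ (y :+ y) :+ z) := x :- y :+ (y :- z))
           refl (central n 0 × 1#) (central n 1 × 1#) (central n 2 × 1#) ⟩
    ballot n 0 + ballot n 1
      ∎

  ballot-suc-suc : ∀ n k → ballot (suc n) (suc k) ≈
    ballot n k + (ballot n (suc k) + ballot n (suc k)) + ballot n (suc (suc k))
  ballot-suc-suc n k = trans
    (+-cong (central-suc-suc-× n k) (-‿cong (central-suc-suc-× n (suc k))))
    (solve 4 (λ x y z u → x :+ (y :+ y) :+ z :- (y :+ (z :+ z) :+ u) :=
        x :- y :+ (y :- z :+ (y :- z)) :+ (z :- u))
      refl (central n k × 1#) (central n (suc k) × 1#)
           (central n (suc (suc k)) × 1#) (central n (suc (suc (suc k))) × 1#))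

  ballot-vanishes : ∀ {n k} → n ℕ.< k → ballot n k ≈ 0#
  ballot-vanishes {n} {k} n<k = begin
    ballot n k  ≈⟨ +-cong (×-congˡ (central-vanishes n<k))
                     (-‿cong (×-congˡ (central-vanishes (ℕ.m<n⇒m<1+n n<k)))) ⟩
    0# - 0#     ≈⟨ -‿inverseʳ 0# ⟩
    0#          ∎

  -- Summation by parts; the last summand on each side is the boundary term.
  ballot-Y : ∀ n f N →
    (∑[ k ≤ N ] (ballot n (toℕ k) * Y f (toℕ k))) + ballot n (suc N) * f N ≈
    (∑[ k ≤ N ] (ballot (suc n) (toℕ k) * f (toℕ k))) + ballot n N * f (suc N)
  ballot-Y n f zero = trans
    (solve 4 (λ x y u v → x :* (v :+ u) :+ con (+ 0) :+ y :* u :=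
                (x :+ y) :* u :+ con (+ 0) :+ x :* v)
      refl (ballot n 0) (ballot n 1) (f 0) (f 1))
    (+-congʳ (+-congʳ (*-congʳ (sym (ballot-suc-zero n)))))
  ballot-Y n f (suc N) = begin
    (∑[ k ≤ suc N ] F (toℕ k)) + b₂ * f₁
      ≈⟨ +-congʳ (∑≤-last N F) ⟩
    ∑F + b₁ * (f₂ + (f₁ + f₁) + f₀) + b₂ * f₁
      -- Isolates `b₁ * f₀`, the boundary term on the left of the induction hypothesis.
      ≈⟨ solve 6 (λ S b₁ b₂ f₀ f₁ f₂ → S :+ b₁ :* (f₂ :+ (f₁ :+ f₁) :+ f₀) :+ b₂ :* f₁ :=
           S :+ b₁ :* f₀ :+ (b₁ :* (f₂ :+ (f₁ :+ f₁)) :+ b₂ :* f₁)) refl ∑F b₁ b₂ f₀ f₁ f₂ ⟩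
    ∑F + b₁ * f₀ + (b₁ * (f₂ + (f₁ + f₁)) + b₂ * f₁)
      ≈⟨ +-congʳ (ballot-Y n f N) ⟩
    ∑G + b₀ * f₁ + (b₁ * (f₂ + (f₁ + f₁)) + b₂ * f₁)
      ≈⟨ solve 6 (λ S b₀ b₁ b₂ f₁ f₂ → S :+ b₀ :* f₁ :+ (b₁ :* (f₂ :+ (f₁ :+ f₁)) :+ b₂ :* f₁) :=
           S :+ (b₀ :+ (b₁ :+ b₁) :+ b₂) :* f₁ :+ b₁ :* f₂) refl ∑G b₀ b₁ b₂ f₁ f₂ ⟩
    ∑G + (b₀ + (b₁ + b₁) + b₂) * f₁ + b₁ * f₂
      ≈⟨ +-congʳ (+-congˡ (*-congʳ (ballot-suc-suc n N))) ⟨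
    ∑G + G (suc N) + b₁ * f₂
      ≈⟨ +-congʳ (∑≤-last N G) ⟨
    (∑[ k ≤ suc N ] G (toℕ k)) + b₁ * f₂
      ∎
    where
    F G : ℕ → Carrier
    F k = ballot n k * Y f k
    G k = ballot (suc n) k * f k

    ∑F ∑G b₀ b₁ b₂ f₀ f₁ f₂ : Carrier
    ∑F = ∑[ k ≤ N ] F (toℕ k)
    ∑G = ∑[ k ≤ N ] G (toℕ k)
    b₀ = ballot n N
    b₁ = ballot n (suc N)
    b₂ = ballot n (suc (suc N))
    f₀ = f N
    f₁ = f (suc N)
    f₂ = f (suc (suc N))

  -- In `ballot-Y` at N = n the left boundary term vanishes, and the right one is the missing
  -- summand k = n + 1, as `ballot (suc n) (suc n)` equals `ballot n n`.
  ballot-sum-suc : ∀ n f →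
    ∑[ k ≤ suc n ] (ballot (suc n) (toℕ k) * f (toℕ k)) ≈
    ∑[ k ≤ n ] (ballot n (toℕ k) * Y f (toℕ k))
  ballot-sum-suc n f = begin
    ∑[ k ≤ suc n ] (ballot (suc n) (toℕ k) * f (toℕ k))
      ≈⟨ ∑≤-last n (λ k → ballot (suc n) k * f k) ⟩
    S′ + ballot (suc n) (suc n) * f (suc n)
      ≈⟨ +-congˡ (*-congʳ (begin
           ballot (suc n) (suc n)
             ≈⟨ ballot-suc-suc n n ⟩
           ballot n n + (ballot n (suc n) + ballot n (suc n)) + ballot n (suc (suc n))
             ≈⟨ +-cong (+-congˡ (+-cong vanishes vanishes))
                  (ballot-vanishes {n} (s≤s (ℕ.n≤1+n n))) ⟩
           ballot n n + (0# + 0#) + 0#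
             ≈⟨ solve 1 (λ x → x :+ (con (+ 0) :+ con (+ 0)) :+ con (+ 0) := x) refl (ballot n n) ⟩
           ballot n n
             ∎)) ⟩
    S′ + ballot n n * f (suc n)
      ≈⟨ ballot-Y n f n ⟨
    S + ballot n (suc n) * f n
      ≈⟨ +-congˡ (*-congʳ vanishes) ⟩
    S + 0# * f n
      ≈⟨ solve 2 (λ x y → x :+ con (+ 0) :* y := x) refl S (f n) ⟩
    S
      ∎
    where
    S S′ : Carrier
    S  = ∑[ k ≤ n ] (ballot n (toℕ k) * Y f (toℕ k))
    S′ = ∑[ k ≤ n ] (ballot (suc n) (toℕ k) * f (toℕ k))

    vanishes : ballot n (suc n) ≈ 0#
    vanishes = ballot-vanishes {n} ℕ.≤-refl

  -- The exponent is `n ℕ.* 2` so that `suc n` exposes two applications of `X`; these act on partial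
  -- sums as `Y`, which the ballot numbers absorb.
  moment-ballot : ∀ n f →
    moment (n ℕ.* 2) f ≈ ∑[ k ≤ n ] (ballot n (toℕ k) * partialSum f (toℕ k))
  moment-ballot zero    f = solve 1 (λ x → x :=
    (con (+ 1) :+ con (+ 0) :- con (+ 0)) :* x :+ con (+ 0)) refl (f 0)
  moment-ballot (suc n) f = begin
    moment (n ℕ.* 2) (X (X f))
      ≈⟨ moment-ballot n (X (X f)) ⟩
    ∑[ k ≤ n ] (ballot n (toℕ k) * partialSum (X (X f)) (toℕ k))
      ≈⟨ sum-cong-≋ {suc n} (λ k → *-congˡ {ballot n (toℕ k)} (partialSum-X² f (toℕ k))) ⟩
    ∑[ k ≤ n ] (ballot n (toℕ k) * Y (partialSum f) (toℕ k))
      ≈⟨ ballot-sum-suc n (partialSum f) ⟨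
    ∑[ k ≤ suc n ] (ballot (suc n) (toℕ k) * partialSum f (toℕ k))
      ∎

  symmetricSum-suc : ∀ k (g : ℕ → Carrier) →
    ∑[ ∣ i ∣≤ suc k ] g ∣ i ∣ ≈ (∑[ ∣ i ∣≤ k ] g ∣ i ∣) + (g (suc k) + g (suc k))
  symmetricSum-suc k g = begin
    ∑[ j ≤ 2 ℕ.* suc k ] g ∣ toℕ j ⊖ suc k ∣
      -- Exposes a double successor in 2(k + 1), so that i = -(k + 1) splits off by computation and
      -- i = k + 1 as the last term.
      ≡⟨ ≡.cong (λ m → ∑[ j ≤ suc m ] g ∣ toℕ j ⊖ suc k ∣) (ℕ.+-suc k (k ℕ.+ 0)) ⟩
    g (suc k) + (∑[ j ≤ suc (2 ℕ.* k) ] g ∣ suc (toℕ j) ⊖ suc k ∣)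
      ≈⟨ +-congˡ (∑≤-last (2 ℕ.* k) (λ j → g ∣ suc j ⊖ suc k ∣)) ⟩
    g (suc k) + ((∑[ j ≤ 2 ℕ.* k ] g ∣ suc (toℕ j) ⊖ suc k ∣) + g ∣ suc (suc (2 ℕ.* k)) ⊖ suc k ∣)
      ≈⟨ +-congˡ (+-cong
           (sum-cong-≋ {suc (2 ℕ.* k)} λ j →
             reflexive (≡.cong (g ∘ ∣_∣) (ℤ.[1+m]⊖[1+n]≡m⊖n (toℕ j) k)))
           (reflexive (≡.cong (g ∘ ∣_∣) last))) ⟩
    g (suc k) + ((∑[ ∣ i ∣≤ k ] g ∣ i ∣) + g (suc k))
      ≈⟨ solve 2 (λ x y → x :+ (y :+ x) := y :+ (x :+ x)) refl (g (suc k)) _ ⟩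
    (∑[ ∣ i ∣≤ k ] g ∣ i ∣) + (g (suc k) + g (suc k))
      ∎
    where
    last : suc (suc (2 ℕ.* k)) ⊖ suc k ≡ + suc k
    last = ≡.trans (≡.cong₂ _⊖_
      (≡.trans (≡.cong (λ m → suc (suc (k ℕ.+ m))) (ℕ.+-identityʳ k))
               (≡.sym (≡.cong suc (ℕ.+-suc k k))))
      (≡.sym (ℕ.+-identityʳ (suc k))))
      (ℤ.+-cancelˡ-⊖ (suc k) (suc k) 0)

  partialSum≈symmetricSum : ∀ {f} (g : ℕ → Carrier) → (∀ k → f (k ℕ.* 2) ≈ g k) →
    ∀ k → partialSum f k ≈ ∑[ ∣ i ∣≤ k ] g ∣ i ∣
  partialSum≈symmetricSum g f≈g zero    = trans (f≈g 0) (sym (+-identityʳ (g 0)))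
  partialSum≈symmetricSum g f≈g (suc k) = trans
    (+-cong (partialSum≈symmetricSum g f≈g k) (+-cong (f≈g (suc k)) (f≈g (suc k))))
    (sym (symmetricSum-suc k g))

-- Sequences supported on one parity class.

module Placement {c ℓ} (R : CommutativeRing c ℓ) where

  open CommutativeRing R hiding (zero)
  open Walks R using (Sequence)
  open IntegerCoefficients R

  -- place f s h is f r if s = h + 2r, and 0 if there is no such r.
  place : Sequence → ℕ → ℕ → Carrier
  place f (suc s)       (suc h) = place f s h
  place f zero          (suc h) = 0#
  place f zero          zero    = f 0
  place f (suc zero)    zero    = 0#
  place f (suc (suc s)) zero    = place (f ∘ suc) s zero

  place-double : ∀ f k → place f (k ℕ.* 2) 0 ≡ f k
  place-double f zero    = ≡.refl
  place-double f (suc k) = place-double (f ∘ suc) k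

  place-vanishes : ∀ f {s h} → s ℕ.< h → place f s h ≈ 0#
  place-vanishes f {zero}  {suc h} _         = refl
  place-vanishes f {suc s} {suc h} (s≤s s<h) = place-vanishes f s<h

  module _ (x : Carrier) where

    -- For s = 2r this is the hypothesis at r, a step of 2 in s being a step of 1 in r; for odd s
    -- all terms vanish.
    place-recurrence-even : ∀ f g k →
      (∀ r → f (suc r) + f r ≈ g r + x * k (suc r)) →
      ∀ s → place f (suc (suc s)) 0 + place f s 0 ≈
            place g s 0 + x * place k (suc (suc s)) 0
    place-recurrence-even f g k eq zero          = eq 0
    place-recurrence-even f g k eq (suc zero)    =
      +-congˡ (sym (zeroʳ x))
    place-recurrence-even f g k eq (suc (suc s)) =
      place-recurrence-even (f ∘ suc) (g ∘ suc) (k ∘ suc) (eq ∘ suc) s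

    place-recurrence-zero : ∀ f g k →
      (∀ r → f (suc r) + f r ≈ g r + x * k (suc r)) →
      ∀ s → place f (suc s) 0 + place f s 1 ≈ place g s 1 + x * place k (suc s) 0
    place-recurrence-zero f g k eq zero    = +-congˡ (sym (zeroʳ x))
    place-recurrence-zero f g k eq (suc s) = place-recurrence-even f g k eq s

    -- For s = h + 2r with r ≥ 1 this is the first hypothesis at r - 1. On the diagonal r = 0 only
    -- `f 0` and `x * k 0` survive, whence the second one; `place-recurrence-zero` has no diagonal
    -- case, because `suc s` is positive.
    place-recurrence-suc : ∀ f g k →
      (∀ r → f (suc r) + f r ≈ g r + x * k (suc r)) → f 0 ≈ x * k 0 →
      ∀ s h → place f (suc s) (suc h) + place f s (suc (suc h)) ≈
              place g s (suc (suc h)) + x * place k (suc s) (suc h)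
    place-recurrence-suc f g k eq eq₀ zero    zero    =
      trans (+-identityʳ _) (trans eq₀ (sym (+-identityˡ _)))
    place-recurrence-suc f g k eq eq₀ zero    (suc h) = +-congˡ (sym (zeroʳ x))
    place-recurrence-suc f g k eq eq₀ (suc s) zero    = place-recurrence-zero f g k eq s
    place-recurrence-suc f g k eq eq₀ (suc s) (suc h) =
      place-recurrence-suc f g k eq eq₀ s h

-- The theta functional and the Al-Salam-Chihara polynomials.

module Theta {c ℓ} (R : CommutativeRing c ℓ) (q : CommutativeRing.Carrier R) where

  open CommutativeRing R hiding (zero)
  open EulerNumbers R
  open import Algebra.Properties.CommutativeSemiring.Exp commutativeSemiring
    using (^-distrib-*; ^-homo-*; ^-congˡ; ^-congʳ)
  open import Algebra.Properties.Semiring.Sum semiring using (sum-cong-≋)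
  open import Relation.Binary.Reasoning.Setoid setoid
  open ContinuedFractions R
  open IntegerCoefficients R
  open Placement R
  open Walks R

  a : Sequence
  a h = (1# - q ^ suc h) * (1# + q ^ h)

  θ : Sequence
  θ r = (- q) ^ (r ℕ.* r)

  -- Here (r + 1)² = r² + 2r + 1, and the sign in (-q)²ʳ disappears. With the ratio polynomial in q
  -- and qʳ, later identities can treat `θ r` and qʳ as indeterminates.
  θ-suc : ∀ r → θ (suc r) ≈ θ r * - (q * (q ^ r * q ^ r))
  θ-suc r = begin
    - q * (- q) ^ (r ℕ.+ r ℕ.* suc r)
      ≈⟨ *-congˡ (^-congʳ (- q) (≡.cong (r ℕ.+_) (ℕ.*-suc r r))) ⟩
    - q * (- q) ^ (r ℕ.+ (r ℕ.+ r ℕ.* r))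
      ≈⟨ *-congˡ (trans (^-homo-* (- q) r _) (*-congˡ (^-homo-* (- q) r _))) ⟩
    - q * ((- q) ^ r * ((- q) ^ r * θ r))
      ≈⟨ solve 3 (λ q x y → :- q :* (x :* (x :* y)) := y :* :- (q :* (x :* x)))
           refl q ((- q) ^ r) (θ r) ⟩
    θ r * - (q * ((- q) ^ r * (- q) ^ r))
      ≈⟨ *-congˡ (-‿cong (*-congˡ (begin
           (- q) ^ r * (- q) ^ r  ≈⟨ ^-distrib-* (- q) (- q) r ⟨
           (- q * - q) ^ r        ≈⟨ ^-congˡ r (solve 1 (λ q → :- q :* :- q := q :* q) refl q) ⟩
           (q * q) ^ r            ≈⟨ ^-distrib-* q q r ⟩
           q ^ r * q ^ r          ∎))) ⟩
    θ r * - (q * (q ^ r * q ^ r))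
      ∎

  -- (1 - q²x²) (1 - q⁴x²) ⋯ (1 - q²ʰx²)
  pochhammer : Carrier → ℕ → Carrier
  pochhammer x zero    = 1#
  pochhammer x (suc h) = (1# - q * x * (q * x)) * pochhammer (q * x) h

  -- The definition splits off the first factor, which suits r ↦ r + 1, that is x ↦ qx; splitting
  -- off the last one suits a change of h. The recurrence for `b` mixes both.
  pochhammer-last : ∀ x h → pochhammer x (suc h) ≈
                    pochhammer x h * (1# - q * q ^ h * x * (q * q ^ h * x))
  pochhammer-last x zero    = solve 2 (λ q x → let one = con (+ 1) in
    (one :- q :* x :* (q :* x)) :* one := one :* (one :- q :* one :* x :* (q :* one :* x))) refl q x
  pochhammer-last x (suc h) = trans (*-congˡ (pochhammer-last (q * x) h))
    (solve 4 (λ q x y z → let one = con (+ 1) in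
      (one :- q :* x :* (q :* x)) :* (z :* (one :- q :* y :* (q :* x) :* (q :* y :* (q :* x)))) :=
      (one :- q :* x :* (q :* x)) :* z :* (one :- q :* (q :* y) :* x :* (q :* (q :* y) :* x)))
      refl q x (q ^ h) (pochhammer (q * x) h))

  -- Closed form for the functional at z^(h+2r) Qₕ; `b-zero`, `b-one`, `b-suc-suc` and `b-start`
  -- check it against the recurrence of the Qₕ.
  b : ℕ → Sequence
  b zero    r = θ r
  b (suc h) r = θ r * (1# - q ^ suc h * (q ^ r * q ^ r)) * pochhammer (q ^ r) h

  b-zero : ∀ r → b 0 (suc r) + b 0 r ≈ b 1 r
  b-zero r = trans (+-congʳ (θ-suc r)) (solve 3 (λ q θ x → let one = con (+ 1) in
    θ :* :- (q :* (x :* x)) :+ θ := θ :* (one :- q :* one :* (x :* x)) :* one)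
    refl q (θ r) (q ^ r))

  b-one : ∀ r → b 1 (suc r) + b 1 r ≈ b 2 r + a 0 * b 0 (suc r)
  b-one r = begin
    θ (suc r) * u * 1# + b 1 r
      ≈⟨ +-congʳ (*-congʳ (*-congʳ (θ-suc r))) ⟩
    θ r * - (q * (q ^ r * q ^ r)) * u * 1# + b 1 r
      ≈⟨ solve 3 (λ q θ x → let one = con (+ 1) in
           θ :* :- (q :* (x :* x)) :* (one :- q :* one :* (q :* x :* (q :* x))) :* one
             :+ θ :* (one :- q :* one :* (x :* x)) :* one
           := θ :* (one :- q :* (q :* one) :* (x :* x)) :* ((one :- q :* x :* (q :* x)) :* one)
             :+ (one :- q :* one) :* (one :+ one) :* (θ :* :- (q :* (x :* x))))
           refl q (θ r) (q ^ r) ⟩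
    b 2 r + a 0 * (θ r * - (q * (q ^ r * q ^ r)))
      ≈⟨ +-congˡ (*-congˡ (θ-suc r)) ⟨
    b 2 r + a 0 * θ (suc r)
      ∎
    where
    u : Carrier
    u = 1# - q ^ 1 * (q ^ suc r * q ^ suc r)

  b-suc-suc : ∀ h r → b (2 ℕ.+ h) (suc r) + b (2 ℕ.+ h) r ≈
              b (3 ℕ.+ h) r + a (suc h) * b (suc h) (suc r)
  b-suc-suc h r = begin
    θ (suc r) * u * pochhammer x′ (suc h) + b (2 ℕ.+ h) r
      -- Every term becomes a multiple of `θ r` and `pochhammer x′ h`, leaving a polynomial identity
      -- in q, qʰ and qʳ.
      ≈⟨ +-congʳ (*-cong (*-congʳ (θ-suc r)) (pochhammer-last x′ h)) ⟩
    θ r * - (q * (q ^ r * q ^ r)) * u * (pochhammer x′ h * v) + b (2 ℕ.+ h) r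
      ≈⟨ solve 5 (λ q θ y x p → let one = con (+ 1) in
           θ :* :- (q :* (x :* x)) :* (one :- q :* (q :* y) :* (q :* x :* (q :* x)))
               :* (p :* (one :- q :* y :* (q :* x) :* (q :* y :* (q :* x))))
             :+ θ :* (one :- q :* (q :* y) :* (x :* x)) :* ((one :- q :* x :* (q :* x)) :* p)
           := θ :* (one :- q :* (q :* (q :* y)) :* (x :* x))
                :* ((one :- q :* x :* (q :* x))
                    :* (p :* (one :- q :* y :* (q :* x) :* (q :* y :* (q :* x)))))
             :+ (one :- q :* (q :* y)) :* (one :+ q :* y)
                :* (θ :* :- (q :* (x :* x)) :* (one :- q :* y :* (q :* x :* (q :* x))) :* p))
           refl q (θ r) (q ^ h) (q ^ r) (pochhammer x′ h) ⟩
    θ r * w * ((1# - x′ * x′) * (pochhammer x′ h * v))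
      + a (suc h) * (θ r * - (q * (q ^ r * q ^ r))
          * (1# - q ^ suc h * (x′ * x′)) * pochhammer x′ h)
      ≈⟨ +-cong (*-congˡ (*-congˡ (pochhammer-last x′ h)))
           (*-congˡ (*-congʳ (*-congʳ (θ-suc r)))) ⟨
    b (3 ℕ.+ h) r + a (suc h) * b (suc h) (suc r)
      ∎
    where
    x′ u v w : Carrier
    x′ = q ^ suc r
    u = 1# - q ^ suc (suc h) * (x′ * x′)
    v = 1# - q * q ^ h * x′ * (q * q ^ h * x′)
    w = 1# - q ^ suc (suc (suc h)) * (q ^ r * q ^ r)

  -- The last factor of the product at x = 1 is 1 - q^(2h+2) = (1 - qʰ⁺¹)(1 + qʰ⁺¹), which supplies
  -- the factor 1 + qʰ⁺¹ of `a (suc h)`.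
  b-start : ∀ h → b (2 ℕ.+ h) 0 ≈ a (suc h) * b (suc h) 0
  b-start h = trans (*-congˡ (pochhammer-last 1# h))
    (solve 3 (λ q y p → let one = con (+ 1) in
      one :* (one :- q :* (q :* y) :* (one :* one))
        :* (p :* (one :- q :* y :* one :* (q :* y :* one)))
      := (one :- q :* (q :* y)) :* (one :+ q :* y)
        :* (one :* (one :- q :* y :* (one :* one)) :* p))
      refl q (q ^ h) (pochhammer 1# h))

  -- B h s is the value of the functional z²ʳ ↦ (-q)^(r²), z²ʳ⁺¹ ↦ 0 at
  -- zˢ Qₕ, where Q₀ = 1, (z + z⁻¹) Q₀ = Q₁ and
  -- (z + z⁻¹) Qₕ₊₁ = Qₕ₊₂ + aₕ Qₕ.
  B : ℕ → Sequence
  B h s = place (b h) s h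

  X-B-zero : ∀ s → X (B 0) s ≈ B 1 s
  X-B-zero zero    = +-identityˡ 0#
  X-B-zero (suc s) = begin
    place θ (suc (suc s)) 0 + place θ s 0
      -- The relation (z + z⁻¹) Q₀ = Q₁ is fitted to three-term form by giving the third sequence
      -- the coefficient `0#`.
      ≈⟨ place-recurrence-even 0# θ (b 1) θ
           (λ r → trans (b-zero r)
             (solve 2 (λ x y → x := x :+ con (+ 0) :* y) refl (b 1 r) (θ (suc r)))) s ⟩
    place (b 1) s 0 + 0# * place θ (suc (suc s)) 0
      ≈⟨ solve 2 (λ x y → x :+ con (+ 0) :* y := x)
           refl (place (b 1) s 0) (place θ (suc (suc s)) 0) ⟩
    place (b 1) s 0
      ∎

  X-B-suc : ∀ h s → X (B (suc h)) s ≈ B (suc (suc h)) s + a h * B h s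
  -- The doubling in `X` at index 0 matches the factor 1 + q⁰ = 2 of `a 0`.
  X-B-suc zero    zero    = solve 1 (λ q →
    let one = con (+ 1)
        b₁₀ = one :* (one :- q :* one :* (one :* one)) :* one
    in b₁₀ :+ b₁₀ := con (+ 0) :+ (one :- q :* one) :* (one :+ one) :* one) refl q
  X-B-suc (suc h) zero    = +-congˡ (sym (zeroʳ (a (suc h))))
  X-B-suc zero    (suc s) = place-recurrence-zero (a 0) (b 1) (b 2) (b 0) b-one s
  X-B-suc (suc h) (suc s) =
    place-recurrence-suc (a (suc h)) (b (2 ℕ.+ h)) (b (3 ℕ.+ h)) (b (suc h))
      (b-suc-suc h) (b-start h) s h

  moment-B-zero : ∀ n → moment (suc n) (B 0) ≈ moment n (B 1)
  moment-B-zero n = moment-cong n X-B-zero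

  moment-B-suc : ∀ n h → moment (suc n) (B (suc h)) ≈
                 moment n (B (suc (suc h))) + a h * moment n (B h)
  moment-B-suc n h = trans (moment-cong n (X-B-suc h))
    (moment-linear n (a h) (B (suc (suc h))) (B h))

  -- Orthogonality of Qₕ to lower powers of z + z⁻¹: the indices s ≤ n < h lie below the diagonal of
  -- `place`.
  moment-B-vanishes : ∀ n {h} → n ℕ.< h → moment n (B h) ≈ 0#
  moment-B-vanishes n {h} n<h = moment-vanishes n λ s s≤n →
    place-vanishes (b h) (ℕ.≤-<-trans s≤n n<h)

  module _ (w : Carrier) (a′ : ℕ → Carrier) (a′≈wa : ∀ h → a′ h ≈ w * a h) where

    -- The functional at (z + z⁻¹)^(2n+h) Qₕ: lower powers give 0 by orthogonality, and those of the
    -- other parity give 0 as well. The power of w supplies the factor that turns aₕ into a′ₕ.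
    G : ℕ → PowerSeries
    G h n = w ^ (h ℕ.+ n) * moment (n ℕ.* 2 ℕ.+ h) (B h)

    contiguous : Contiguous a′ one G
    contiguous .Contiguous.start-zero  = *-identityˡ 1#
    contiguous .Contiguous.start-suc n = begin
      w ^ suc n * moment (suc (suc (n ℕ.* 2 ℕ.+ 0))) (B 0)
        ≈⟨ *-congˡ (moment-B-zero (suc (n ℕ.* 2 ℕ.+ 0))) ⟩
      w ^ suc n * moment (suc (n ℕ.* 2 ℕ.+ 0)) (B 1)
        ≡⟨ ≡.cong (λ m → w ^ suc n * moment m (B 1)) (ℕ.+-suc (n ℕ.* 2) 0) ⟨
      w ^ suc n * moment (n ℕ.* 2 ℕ.+ 1) (B 1)
        ≈⟨ +-identityˡ _ ⟨
      0# + w ^ suc n * moment (n ℕ.* 2 ℕ.+ 1) (B 1)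
        ∎
    contiguous .Contiguous.step-zero h = begin
      w * w ^ (h ℕ.+ 0) * moment (suc h) (B (suc h))
        -- Orthogonality removes the term with Qₕ₊₂.
        ≈⟨ *-congˡ (trans (moment-B-suc h h)
             (+-congʳ (moment-B-vanishes h (s≤s (ℕ.n≤1+n h))))) ⟩
      w * w ^ (h ℕ.+ 0) * (0# + a h * moment h (B h))
        ≈⟨ solve 4 (λ w x y z → w :* x :* (con (+ 0) :+ y :* z) := w :* y :* (x :* z))
             refl w (w ^ (h ℕ.+ 0)) (a h) (moment h (B h)) ⟩
      w * a h * G h 0
        ≈⟨ *-congʳ (a′≈wa h) ⟨
      a′ h * G h 0
        ∎
    contiguous .Contiguous.step-suc h n = begin
      w * w ^ (h ℕ.+ suc n) * moment (suc (suc m)) (B (suc h))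
        ≈⟨ *-congˡ (moment-B-suc (suc m) h) ⟩
      w * w ^ (h ℕ.+ suc n) * (moment (suc m) (B (suc (suc h))) + a h * moment (suc m) (B h))
        ≈⟨ solve 5 (λ w x y z u → w :* x :* (u :+ y :* z) := w :* y :* (x :* z) :+ w :* x :* u)
             refl w (w ^ (h ℕ.+ suc n)) (a h) (moment (suc m) (B h))
                  (moment (suc m) (B (suc (suc h)))) ⟩
      w * a h * (w ^ (h ℕ.+ suc n) * moment (suc m) (B h))
        + w * w ^ (h ℕ.+ suc n) * moment (suc m) (B (suc (suc h)))
        ≈⟨ +-cong
             (*-cong (sym (a′≈wa h))
               (reflexive (≡.cong (λ m → w ^ (h ℕ.+ suc n) * moment (suc m) (B h))
                 (ℕ.+-suc (n ℕ.* 2) h))))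
             (reflexive (≡.cong₂ (λ k m → w * w ^ k * moment m (B (suc (suc h))))
               (ℕ.+-suc h n) (≡.sym (ℕ.+-suc (n ℕ.* 2) (suc h))))) ⟩
      a′ h * G h (suc n) + G (suc (suc h)) n
        ∎
      where
      m : ℕ
      m = n ℕ.* 2 ℕ.+ suc h

    continuedFraction≈moment : ∀ n → continuedFraction a′ n ≈ w ^ n * moment (n ℕ.* 2) (B 0)
    continuedFraction≈moment n = begin
      continuedFraction a′ n
        ≈⟨ contiguous⇒continuedFraction contiguous n ⟨
      w ^ n * moment (n ℕ.* 2 ℕ.+ 0) (B 0)
        ≡⟨ ≡.cong (λ m → w ^ n * moment m (B 0)) (ℕ.+-identityʳ (n ℕ.* 2)) ⟩
      w ^ n * moment (n ℕ.* 2) (B 0)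
        ∎

  moment-B : ∀ n → moment (n ℕ.* 2) (B 0) ≈
    ∑[ k ≤ n ] (ballot n (toℕ k) * (∑[ ∣ i ∣≤ toℕ k ] ((- q) ^ ∣ i ℤ.* i ∣)))
  moment-B n = trans (moment-ballot n (B 0))
    (sum-cong-≋ {suc n} λ k → *-congˡ {ballot n (toℕ k)} (trans
      (partialSum≈symmetricSum {B 0} θ (λ k → reflexive (place-double θ k)) (toℕ k))
      (sum-cong-≋ {suc (2 ℕ.* toℕ k)} λ j → reflexive (≡.cong ((- q) ^_)
        (≡.sym (ℤ.abs-* (toℕ j ⊖ toℕ k) (toℕ j ⊖ toℕ k)))))))

proposition5p16 : ∀ {c ℓ} (R : CommutativeRing c ℓ) →
    let open CommutativeRing R
        open EulerNumbers R
    in (q : Carrier) (q-inv : Invertible q) (1-q-inv : Invertible (1# - q)) (n : ℕ) →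
       E (- 1# / q-inv) q 1-q-inv n
         ≈ (1# / 1-q-inv) ^ (2 ℕ.* n)
           * (∑[ k ≤ n ] ((((2 ℕ.* n) choose (n ⊖ toℕ k)) × 1#
                           - ((2 ℕ.* n) choose (n ⊖ suc (toℕ k))) × 1#)
                         * (∑[ ∣ i ∣≤ toℕ k ] ((- q) ^ ∣ i ℤ.* i ∣))))
proposition5p16 R q q-inv 1-q-inv n =
  -- Each of the two brackets contributes one factor (1 - q)⁻¹, so w is `v ^ 2`.
  trans (continuedFraction≈moment (v ^ 2) (λ m → [ suc m ]q * [ suc m ]t,q) coefficient n)
        (*-cong (^-assocʳ v 2 n) (moment-B n))
  where
  open CommutativeRing R
  open EulerNumbers R hiding ([_]q; [_]t,q)
  open import Algebra.Properties.Semiring.Exp semiring using (^-assocʳ)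
  open import Relation.Binary.Reasoning.Setoid setoid
  open IntegerCoefficients R
  open Theta R q

  t u v : Carrier
  t = - 1# / q-inv
  u = proj₁ 1-q-inv
  v = 1# / 1-q-inv

  [_]q [_]t,q : ℕ → Carrier
  [ m ]q   = EulerNumbers.[_]q R t q 1-q-inv m
  [ m ]t,q = EulerNumbers.[_]t,q R t q 1-q-inv m

  coefficient : ∀ h → [ suc h ]q * [ suc h ]t,q ≈ v ^ 2 * a h
  coefficient h = begin
    (1# - q * x) * u * ((1# - - 1# * q⁻¹ * (q * x)) * u)
      ≈⟨ solve 4 (λ q q⁻¹ u x → let one = con (+ 1) in
           (one :- q :* x) :* u :* ((one :- :- one :* q⁻¹ :* (q :* x)) :* u) :=
           (one :- q :* x) :* u :* ((one :+ q⁻¹ :* q :* x) :* u)) refl q q⁻¹ u x ⟩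
    (1# - q * x) * u * ((1# + q⁻¹ * q * x) * u)
      -- To the solver q⁻¹ is an indeterminate, so the law q⁻¹ q = 1 is applied by hand; it turns 1
      -- - t qʰ⁺¹ into 1 + qʰ.
      ≈⟨ *-congˡ (*-congʳ (+-congˡ (*-congʳ (proj₁ (proj₂ q-inv))))) ⟩
    (1# - q * x) * u * ((1# + 1# * x) * u)
      ≈⟨ solve 3 (λ q u x → let one = con (+ 1) ; v = one :* u in
           (one :- q :* x) :* u :* ((one :+ one :* x) :* u) :=
           v :* (v :* one) :* ((one :- q :* x) :* (one :+ x))) refl q u x ⟩
    v ^ 2 * a h
      ∎
    where
    q⁻¹ x : Carrier
    q⁻¹ = proj₁ q-inv
    x = q ^ h
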